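{- For an arbitrary integer $k\ge 3$ and an arbitrary integer $n$ with $\frac{k+1}{2} \leq n \leq k$, there exists a finite simple graph $G$ with an edge $e$ such that $\chi_\rho(G)=k$ and $\chi_\rho(G-e)=n$.
   Context: A $k$-packing coloring of a graph $G$ is a map $c:V(G)\to\{1,\ldots,k\}$ such that two distinct vertices $u,v$ with $c(u)=c(v)=i$ satisfy $d_G(u,v)>i$ (distance between vertices in different components is infinite). The packing chromatic number $\chi_\rho(G)$ is the smallest $k$ for which $G$ admits a $k$-packing coloring. $G-e$ denotes the graph obtained by deleting the edge $e$. -}

module Defs where

open import Data.Fin using (Fin; toℕ; _≟_)
open import Data.Nat using (ℕ; suc; _≤_; _<_)
open import Data.Product using (Σ-syntax; ∃-syntax; _×_; _,_)
open import Level using (0ℓ)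
open import Relation.Binary.Construct.Closure.ReflexiveTransitive using (Star; ε; _◅_)
open import Relation.Binary.Core using (Rel)
open import Relation.Binary.Definitions using (Decidable; Symmetric)
open import Relation.Binary.PropositionalEquality using (_≡_; _≢_)
open import Relation.Nullary using (¬_)
open import Relation.Nullary.Decidable using (_×-dec_; ¬?)

-- Decidability of adjacency is automatic for a classical finite graph;
-- constructively it has to be part of the data.
record Graph : Set₁ where
  field
    order  : ℕ
    Adj    : Rel (Fin order) 0ℓ
    adj?   : Decidable Adj
    sym    : Symmetric Adj
    irrefl : ∀ {v} → ¬ Adj v v

  Vertex : Set
  Vertex = Fin order

  Edge : Set
  Edge = Σ[ u ∈ Vertex ] Σ[ v ∈ Vertex ] Adj u v

  Walk : Rel Vertex 0ℓ
  Walk = Star Adj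

  length : ∀ {u v} → Walk u v → ℕ
  length ε       = 0
  length (_ ◅ w) = suc (length w)

  IsDistance : Vertex → Vertex → ℕ → Set
  IsDistance u v d = (Σ[ w ∈ Walk u v ] length w ≡ d) × (∀ (w : Walk u v) → d ≤ length w)

  -- d(u,v) > i in ℕ ∪ {∞}: vertices in different components have no
  -- finite distance, so the condition then holds for every i.
  Distance> : Vertex → Vertex → ℕ → Set
  Distance> u v i = ∀ d → IsDistance u v d → i < d

  -- The element j of Fin k stands for the colour 1 + j of {1,…,k}.
  colour : ∀ {k} → Fin k → ℕ
  colour j = suc (toℕ j)

  IsPackingColouring : (k : ℕ) → (Vertex → Fin k) → Set
  IsPackingColouring k c = ∀ u v → u ≢ v → c u ≡ c v → Distance> u v (colour (c u))

  PackingColourable : ℕ → Set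
  PackingColourable k = ∃[ c ] IsPackingColouring k c

  IsPackingChromaticNumber : ℕ → Set
  IsPackingChromaticNumber k = PackingColourable k × (∀ j → PackingColourable j → k ≤ j)

open Graph public using (Edge; IsPackingChromaticNumber)

-- An Edge carries an orientation (u , v), so both orientations are removed.
infixl 6 _-ₑ_
_-ₑ_ : (G : Graph) → Edge G → Graph
G -ₑ (u , v , _) = record
  { order  = order
  ; Adj    = λ x y → Adj x y × ¬ (x ≡ u × y ≡ v) × ¬ (y ≡ u × x ≡ v)
  ; adj?   = λ x y → adj? x y ×-dec ¬? ((x ≟ u) ×-dec (y ≟ v)) ×-dec ¬? ((y ≟ u) ×-dec (x ≟ v))
  ; sym    = λ (a , p , q) → sym a , q , p
  ; irrefl = λ (a , _) → irrefl a
  }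
  where open Graph G

{-# OPTIONS --safe #-}

-- For n < k, join the cliques on p + 1 = n and q + 1 = k ∸ n + 1 vertices by
-- an edge e between a "hub" of each, and attach k leaves to every other clique
-- vertex.  In G - e the hubs and the leaves can share colour 1, and n colours
-- are needed and suffice.  In G the leaves keep colour 1 away from the non-hubs.
-- The clique vertices are pairwise at distance at most 3, with equality only
-- between non-hubs of different cliques; hence colour 2 is the only one that can
-- be repeated on the p + q + 2 clique vertices, and it is used at most twice,
-- which gives p + q + 1 = k colours.
-- For n = k, delete the edge of the component K_2 in the disjoint union of K_2
-- and K_k.
module Submission where

open import Defs
open import Data.Nat using (ℕ; zero; suc; _+_; _*_; _∸_; _≤_; _<_; z≤n; s≤s)
open import Data.Product using (Σ-syntax; _×_; _,_; proj₁; proj₂)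
open import Data.Bool as Bool using (Bool; true; false)
open import Data.Empty using (⊥)
open import Data.Fin using (Fin; zero; suc; toℕ; inject≤; join; splitAt; punchIn; _≟_)
open import Data.Fin.Properties using (toℕ-injective; inject≤-injective; injective⇒≤; any?; punchIn-injective; punchInᵢ≢i; splitAt-join; join-splitAt; suc-injective; *↔×; +↔⊎)
open import Data.Nat.Induction using (<-rec)
open import Data.Nat.Properties as ℕ using (≮⇒≥; ≤-trans; <⇒≱; ≤∧≢⇒<; m+[n∸m]≡n; +-assoc; +-comm; +-identityʳ; +-cancelˡ-≤; _≤?_; n≢0⇒n>0)
open import Data.Product.Function.NonDependent.Propositional using (_×-↔_)
open import Data.Sum using (_⊎_; inj₁; inj₂)
open import Data.Sum.Properties using (≡-dec)
open import Function using (_∘_)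
open import Function.Bundles using (_↔_; module Inverse)
open import Function.Construct.Composition using (_↔-∘_)
open import Function.Construct.Identity using (↔-id)
open import Relation.Binary.Construct.Closure.ReflexiveTransitive using (ε; _◅_)
open import Relation.Binary.Definitions using (Decidable; Symmetric)
open import Relation.Binary.PropositionalEquality using (_≡_; _≢_; refl; sym; trans; cong; subst; subst₂; ≢-sym)
open import Relation.Nullary using (¬_; Dec; yes; no; contradiction)
open import Relation.Nullary.Decidable using (_×-dec_; ¬?; decidable-stable)

-- Distance bounds and packing colourings in an arbitrary graph.

module Packing (G : Graph) where
  open Graph G hiding (sym)

  nonadjacent⇒Distance>1 : ∀ {x y} → x ≢ y → ¬ Adj x y → Distance> x y 1
  nonadjacent⇒Distance>1 x≢y ¬xy _ ((ε , refl) , _)         = contradiction refl x≢y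
  nonadjacent⇒Distance>1 x≢y ¬xy _ ((a ◅ ε , refl) , _)     = contradiction a ¬xy
  nonadjacent⇒Distance>1 x≢y ¬xy _ ((_ ◅ _ ◅ _ , refl) , _) = s≤s (s≤s z≤n)

  no-common-neighbour⇒Distance>2 : ∀ {x y} → x ≢ y → ¬ Adj x y →
    (∀ z → Adj x z → ¬ Adj z y) → Distance> x y 2
  no-common-neighbour⇒Distance>2 x≢y ¬xy ¬xzy _ ((ε , refl) , _)             = contradiction refl x≢y
  no-common-neighbour⇒Distance>2 x≢y ¬xy ¬xzy _ ((a ◅ ε , refl) , _)         = contradiction a ¬xy
  no-common-neighbour⇒Distance>2 x≢y ¬xy ¬xzy _ ((a ◅ b ◅ ε , refl) , _)     = contradiction b (¬xzy _ a)
  no-common-neighbour⇒Distance>2 x≢y ¬xy ¬xzy _ ((_ ◅ _ ◅ _ ◅ _ , refl) , _) = s≤s (s≤s (s≤s z≤n))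

  disconnected⇒Distance> : ∀ {S : Set} (f : Vertex → S) → (∀ {x y} → Adj x y → f x ≡ f y) →
    ∀ {x y} → f x ≢ f y → ∀ i → Distance> x y i
  disconnected⇒Distance> f f-inv fx≢fy i _ ((w , _) , _) = contradiction (constant w) fx≢fy
    where
    constant : ∀ {x y} → Walk x y → f x ≡ f y
    constant ε       = refl
    constant (a ◅ w) = trans (f-inv a) (constant w)

  -- Distinct vertices of equal colour lie in different fibres of `f`. No walk leaves a fibre, so
  -- their distance is infinite, whatever the colour.
  fibrewise-injective⇒packing : ∀ {S : Set} (f : Vertex → S) → (∀ {x y} → Adj x y → f x ≡ f y) →
    ∀ {k} {c : Vertex → Fin k} → (∀ x y → f x ≡ f y → c x ≡ c y → x ≡ y) → IsPackingColouring k c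
  fibrewise-injective⇒packing f f-inv c-inj x y x≢y cx≡cy =
    disconnected⇒Distance> f f-inv (λ fx≡fy → x≢y (c-inj x y fx≡fy cx≡cy)) _

  -- A shortest walk cannot be computed from w, but to reach a contradiction it
  -- suffices to rule out walks of length ≤ i by strong induction on their length.
  Distance>⇒longer : ∀ {x y i} → Distance> x y i → (w : Walk x y) → i < length w
  Distance>⇒longer {x} {y} {i} far w =
    decidable-stable (suc i ≤? length w) λ i≮ → none (length w) (≮⇒≥ i≮) w refl
    where
    none : ∀ d → d ≤ i → (w : Walk x y) → length w ≢ d
    none = <-rec _ λ d rec d≤i w w≡d →
      contradiction d≤i (<⇒≱ (far d ((w , w≡d) ,
        λ w′ → ≮⇒≥ λ w′<d → rec w′<d (≤-trans (ℕ.<⇒≤ w′<d) d≤i) w′ refl)))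

  module _ {j} {c : Vertex → Fin j} (packing : IsPackingColouring j c) where

    -- `suc (toℕ (c x))` is the colour of `x` counted from 1. Any walk of at most that length will
    -- do, since it bounds the distance from above.
    close⇒≢ : ∀ {x y} → x ≢ y → (w : Walk x y) → length w ≤ suc (toℕ (c x)) → c x ≢ c y
    close⇒≢ x≢y w short cx≡cy = <⇒≱ (Distance>⇒longer (packing _ _ x≢y cx≡cy) w) short

    adjacent⇒≢ : ∀ {x y} → Adj x y → c x ≢ c y
    adjacent⇒≢ a = close⇒≢ (λ { refl → irrefl a }) (a ◅ ε) (s≤s z≤n)

    clique⇒≤ : ∀ {m} (f : Fin m → Vertex) → (∀ {x y} → x ≢ y → Adj (f x) (f y)) → m ≤ j
    clique⇒≤ f f-adj = injective⇒≤ {f = c ∘ f} λ {x} {y} eq →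
      decidable-stable (x ≟ y) λ x≢y → adjacent⇒≢ (f-adj x≢y) eq

    -- Leaves of a vertex of colour 1 avoid colour 1, so they get distinct colours.
    star⇒≤ : ∀ {m} x (f : Fin m → Vertex) → (∀ l → Adj (f l) x) →
      (∀ {l l′} → f l ≡ f l′ → l ≡ l′) → toℕ (c x) ≡ 0 → m ≤ j
    star⇒≤ x f f-adj f-inj cx≡0 = injective⇒≤ {f = c ∘ f} λ {l} {l′} eq →
      decidable-stable (l ≟ l′) λ l≢l′ →
        close⇒≢ (l≢l′ ∘ f-inj) (f-adj l ◅ Graph.sym G (f-adj l′) ◅ ε)
          (s≤s (n≢0⇒n>0 λ cl≡0 → adjacent⇒≢ (f-adj l) (toℕ-injective (trans cl≡0 (sym cx≡0))))) eq

-- The case n = k: a disjoint pair and clique.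

module TwoAndClique (m : ℕ) where

  inPair : Fin (2 + m) → Bool
  inPair zero          = true
  inPair (suc zero)    = true
  inPair (suc (suc _)) = false

  pair+clique : Graph
  pair+clique = record
    { order  = 2 + m
    ; Adj    = λ x y → inPair x ≡ inPair y × x ≢ y
    ; adj?   = λ x y → (inPair x Bool.≟ inPair y) ×-dec ¬? (x ≟ y)
    ; sym    = λ (same , x≢y) → sym same , ≢-sym x≢y
    ; irrefl = λ (_ , x≢x) → x≢x refl
    }

  pairEdge : Edge pair+clique
  pairEdge = zero , suc zero , refl , λ ()

-- The clique alone forces `2 + m` colours and keeps all its edges, while the pair reuses two of
-- them. `inPair` stays constant along edges after the deletion, so one colouring serves both
-- graphs.
pair+clique-chromatic : ∀ m → let open TwoAndClique (2 + m) in
  IsPackingChromaticNumber pair+clique (2 + m) ×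
  IsPackingChromaticNumber (pair+clique -ₑ pairEdge) (2 + m)
pair+clique-chromatic m =
  ((c , fibrewise-injective⇒packing pair+clique inPair proj₁ c-injective) ,
    λ j (_ , pk) → clique⇒≤ pair+clique pk (λ i → suc (suc i)) clique) ,
  ((c , fibrewise-injective⇒packing (pair+clique -ₑ pairEdge) inPair (proj₁ ∘ proj₁) c-injective) ,
    λ j (_ , pk) → clique⇒≤ (pair+clique -ₑ pairEdge) pk (λ i → suc (suc i))
      λ x≢y → clique x≢y , (λ ()) , λ ())
  where
  open TwoAndClique (2 + m)
  open Packing

  c : Fin (4 + m) → Fin (2 + m)
  c zero          = zero
  c (suc zero)    = suc zero
  c (suc (suc i)) = i

  c-injective : ∀ x y → inPair x ≡ inPair y → c x ≡ c y → x ≡ y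
  c-injective zero          zero          _ _    = refl
  c-injective zero          (suc zero)    _ ()
  c-injective zero          (suc (suc _)) ()
  c-injective (suc zero)    zero          _ ()
  c-injective (suc zero)    (suc (suc _)) ()
  c-injective (suc (suc _)) zero          ()
  c-injective (suc (suc _)) (suc zero)    ()
  c-injective (suc zero)    (suc zero)    _ _    = refl
  c-injective (suc (suc _)) (suc (suc _)) _ refl = refl

  clique : ∀ {x y : Fin (2 + m)} → x ≢ y → Graph.Adj pair+clique (suc (suc x)) (suc (suc y))
  clique x≢y = refl , x≢y ∘ suc-injective ∘ suc-injective

-- The case n < k: two bridged cliques with leaves.

-- Clique vertices number 0 are the hubs.  A vertex (x , zero) is the clique
-- vertex x, and (x , suc l) is its l-th leaf; the "leaves" of the hubs are
-- isolated vertices, kept only to make the vertex set a product.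
module Bridge (p q L : ℕ) where

  Core V : Set
  Core = Fin (suc p) ⊎ Fin (suc q)
  V    = Core × Fin (suc L)

  Hub : Core → Set
  Hub (inj₁ i) = i ≡ zero
  Hub (inj₂ j) = j ≡ zero

  hub? : ∀ x → Dec (Hub x)
  hub? (inj₁ i) = i ≟ zero
  hub? (inj₂ j) = j ≟ zero

  _~_ : Core → Core → Set
  inj₁ i ~ inj₁ i′ = i ≢ i′
  inj₁ i ~ inj₂ j  = i ≡ zero × j ≡ zero
  inj₂ j ~ inj₁ i  = i ≡ zero × j ≡ zero
  inj₂ j ~ inj₂ j′ = j ≢ j′

  ~-dec : Decidable _~_
  ~-dec (inj₁ i) (inj₁ i′) = ¬? (i ≟ i′)
  ~-dec (inj₁ i) (inj₂ j)  = (i ≟ zero) ×-dec (j ≟ zero)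
  ~-dec (inj₂ j) (inj₁ i)  = (i ≟ zero) ×-dec (j ≟ zero)
  ~-dec (inj₂ j) (inj₂ j′) = ¬? (j ≟ j′)

  ~-sym : Symmetric _~_
  ~-sym {inj₁ _} {inj₁ _} = ≢-sym
  ~-sym {inj₁ _} {inj₂ _} a = a
  ~-sym {inj₂ _} {inj₁ _} a = a
  ~-sym {inj₂ _} {inj₂ _} = ≢-sym

  ~-irrefl : ∀ x → ¬ (x ~ x)
  ~-irrefl (inj₁ _) i≢i = i≢i refl
  ~-irrefl (inj₂ _) j≢j = j≢j refl

  _≟ᶜ_ : Decidable {A = Core} _≡_
  _≟ᶜ_ = ≡-dec _≟_ _≟_

  Link : V → V → Set
  Link (x , zero)  (y , zero)  = x ~ y
  Link (x , zero)  (y , suc _) = x ≡ y × ¬ Hub x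
  Link (x , suc _) (y , zero)  = y ≡ x × ¬ Hub y
  Link (x , suc _) (y , suc _) = ⊥

  link? : Decidable Link
  link? (x , zero)  (y , zero)  = ~-dec x y
  link? (x , zero)  (y , suc _) = (x ≟ᶜ y) ×-dec ¬? (hub? x)
  link? (x , suc _) (y , zero)  = (y ≟ᶜ x) ×-dec ¬? (hub? y)
  link? (x , suc _) (y , suc _) = no λ ()

  link-sym : Symmetric Link
  link-sym {x , zero}  {y , zero}  = ~-sym {x} {y}
  link-sym {_ , zero}  {_ , suc _} a = a
  link-sym {_ , suc _} {_ , zero}  a = a

  link-irrefl : ∀ v → ¬ Link v v
  link-irrefl (x , zero) = ~-irrefl x

  -- Vertices have to form some `Fin`. The argument works in `V` and uses this bijection only
  -- through its two inverse laws.
  opaque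
    enumeration : Fin ((suc p + suc q) * suc L) ↔ V
    enumeration = (+↔⊎ ×-↔ ↔-id _) ↔-∘ *↔×

  open Inverse enumeration public using () renaming (to to dec; from to enc)

  dec-enc : ∀ v → dec (enc v) ≡ v
  dec-enc = Inverse.strictlyInverseˡ enumeration

  enc-dec : ∀ x → enc (dec x) ≡ x
  enc-dec = Inverse.strictlyInverseʳ enumeration

  enc-injective : ∀ {v w} → enc v ≡ enc w → v ≡ w
  enc-injective {v} {w} eq = trans (sym (dec-enc v)) (trans (cong dec eq) (dec-enc w))

  H : Graph
  H = record
    { order  = (suc p + suc q) * suc L
    ; Adj    = λ x y → Link (dec x) (dec y)
    ; adj?   = λ x y → link? (dec x) (dec y)
    ; sym    = λ {x} {y} → link-sym {dec x} {dec y}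
    ; irrefl = λ {x} → link-irrefl (dec x)
    }

  core : Core → Fin ((suc p + suc q) * suc L)
  core x = enc (x , zero)

  core-injective : ∀ {x y} → core x ≡ core y → x ≡ y
  core-injective = cong proj₁ ∘ enc-injective

  link⇒adj : ∀ v w → Link v w → Graph.Adj H (enc v) (enc w)
  link⇒adj v w = subst₂ Link (sym (dec-enc v)) (sym (dec-enc w))

  core-adj : ∀ x y → x ~ y → Graph.Adj H (core x) (core y)
  core-adj x y = link⇒adj (x , zero) (y , zero)

  bridge : Edge H
  bridge = core (inj₁ zero) , core (inj₂ zero) , core-adj (inj₁ zero) (inj₂ zero) (refl , refl)

  H⁻ : Graph
  H⁻ = H -ₑ bridge

  left : V → Bool
  left (inj₁ _ , _) = true
  left (inj₂ _ , _) = false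

  -- The sides meet only in the link between the two hubs; the hypotheses exclude both of its
  -- orientations.
  link⇒left : ∀ v w → Link v w →
    ¬ (v ≡ (inj₁ zero , zero) × w ≡ (inj₂ zero , zero)) →
    ¬ (w ≡ (inj₁ zero , zero) × v ≡ (inj₂ zero , zero)) → left v ≡ left w
  link⇒left (inj₁ _ , zero)  (inj₁ _ , zero)  _             _  _  = refl
  link⇒left (inj₁ _ , zero)  (inj₂ _ , zero)  (refl , refl) ¬e _  = contradiction (refl , refl) ¬e
  link⇒left (inj₂ _ , zero)  (inj₁ _ , zero)  (refl , refl) _  ¬e = contradiction (refl , refl) ¬e
  link⇒left (inj₂ _ , zero)  (inj₂ _ , zero)  _             _  _  = refl
  link⇒left (inj₁ _ , zero)  (_ , suc _)      (refl , _)    _  _  = refl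
  link⇒left (inj₂ _ , zero)  (_ , suc _)      (refl , _)    _  _  = refl
  link⇒left (_ , suc _)      (inj₁ _ , zero)  (refl , _)    _  _  = refl
  link⇒left (_ , suc _)      (inj₂ _ , zero)  (refl , _)    _  _  = refl

  adj⁻⇒left : ∀ {x y} → Graph.Adj H⁻ x y → left (dec x) ≡ left (dec y)
  adj⁻⇒left {x} {y} (a , ¬e , ¬e′) = link⇒left (dec x) (dec y) a
    (λ (x≡ , y≡) → ¬e (encode x≡ , encode y≡))
    (λ (y≡ , x≡) → ¬e′ (encode y≡ , encode x≡))
    where
    encode : ∀ {x v} → dec x ≡ v → x ≡ enc v
    encode {x} eq = trans (sym (enc-dec x)) (cong enc eq)

  -- Colourings that give colour 1 to every leaf.

  paint : ∀ {m} → (Core → Fin (suc m)) → V → Fin (suc m)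
  paint κ (x , zero)  = κ x
  paint κ (_ , suc _) = zero

  -- Colour 1 only forbids adjacency. Leaves are pairwise nonadjacent, and a clique vertex of colour
  -- 1 is a hub, which has no leaves. Only pairs of clique vertices remain, left to the last
  -- hypothesis. The map `f` into `V` lets the lemma cover both `H` and `H⁻`.
  paint-packing : ∀ {m} (κ : Core → Fin (suc m)) → (∀ x → κ x ≡ zero → Hub x) →
    (G : Graph) (let open Graph G using (Vertex; Adj; Distance>; IsPackingColouring)) →
    (f : Vertex → V) → (∀ {x y} → f x ≡ f y → x ≡ y) → (∀ {x y} → Adj x y → Link (f x) (f y)) →
    (∀ {x y a b} → f x ≡ (a , zero) → f y ≡ (b , zero) → x ≢ y → a ≢ b → κ a ≡ κ b →
      Distance> x y (suc (toℕ (κ a)))) →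
    IsPackingColouring (suc m) (paint κ ∘ f)
  paint-packing κ κ-hub G f f-inj hom far x y x≢y = go (f x) (f y) refl refl
    where
    open Graph G using (Distance>)

    nonlinked : ¬ Link (f x) (f y) → Distance> x y 1
    nonlinked ¬l = Packing.nonadjacent⇒Distance>1 G x≢y (¬l ∘ hom)

    go : ∀ v w → f x ≡ v → f y ≡ w → paint κ v ≡ paint κ w → Distance> x y (suc (toℕ (paint κ v)))
    go (a , zero) (b , zero) fx fy eq = far fx fy x≢y
      (λ { refl → x≢y (f-inj (trans fx (sym fy))) }) eq
    go (a , zero) (b , suc _) fx fy eq rewrite eq = nonlinked
      (subst₂ (λ v w → ¬ Link v w) (sym fx) (sym fy) λ (_ , ¬hub) → ¬hub (κ-hub a eq))
    go (a , suc _) (b , zero) fx fy eq = nonlinked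
      (subst₂ (λ v w → ¬ Link v w) (sym fx) (sym fy) λ (_ , ¬hub) → ¬hub (κ-hub b (sym eq)))
    go (a , suc _) (b , suc _) fx fy eq = nonlinked
      (subst₂ (λ v w → ¬ Link v w) (sym fx) (sym fy) λ ())

  dec-injective : ∀ {x y} → dec x ≡ dec y → x ≡ y
  dec-injective {x} {y} eq = trans (sym (enc-dec x)) (trans (cong enc eq) (enc-dec y))

  -- Without the bridge the sides are disconnected, so the second clique can reuse the colours of
  -- the first, which is at least as large. Both hubs get colour 1. The first clique keeps all its
  -- edges and gives the lower bound.
  H⁻-chromatic : q ≤ p → IsPackingChromaticNumber H⁻ (suc p)
  H⁻-chromatic q≤p = (paint κ ∘ dec , paint-packing κ κ-hub H⁻ dec dec-injective proj₁ far) ,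
    λ j (_ , pk) → Packing.clique⇒≤ H⁻ pk (core ∘ inj₁) λ {i} {i′} i≢i′ →
      core-adj (inj₁ i) (inj₁ i′) i≢i′ ,
      (λ (_ , eq) → inj₁≢inj₂ (core-injective eq)) ,
      (λ (_ , eq) → inj₁≢inj₂ (core-injective eq))
    where
    inj₁≢inj₂ : ∀ {i j} → _≢_ {A = Core} (inj₁ i) (inj₂ j)
    inj₁≢inj₂ ()

    κ : Core → Fin (suc p)
    κ (inj₁ i) = i
    κ (inj₂ j) = inject≤ j (s≤s q≤p)

    κ-hub : ∀ x → κ x ≡ zero → Hub x
    κ-hub (inj₁ _)    eq = eq
    κ-hub (inj₂ zero) _  = refl

    κ-injective : ∀ a b → a ≢ b → κ a ≡ κ b → left (a , zero) ≢ left (b , zero)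
    κ-injective (inj₁ _) (inj₁ _) a≢b eq _ = a≢b (cong inj₁ eq)
    κ-injective (inj₂ _) (inj₂ _) a≢b eq _ = a≢b (cong inj₂ (inject≤-injective _ _ _ _ eq))

    far : ∀ {x y a b} → dec x ≡ (a , zero) → dec y ≡ (b , zero) → x ≢ y → a ≢ b → κ a ≡ κ b →
      Graph.Distance> H⁻ x y (suc (toℕ (κ a)))
    far {a = a} {b} dx dy _ a≢b eq = Packing.disconnected⇒Distance> H⁻ (left ∘ dec)
      (λ {x} {y} → adj⁻⇒left {x} {y})
      (λ same → κ-injective a b a≢b eq (trans (cong left (sym dx)) (trans same (cong left dy)))) _

-- The chromatic number of the bridged graph.

module _ (p′ q′ : ℕ) where
  private
    p q k : ℕ
    p = suc p′
    q = suc q′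
    k = suc p + q

  -- With `k` leaves at each non-hub, a non-hub of colour 1 would force `k` colours on its leaves.
  open Bridge p q k

  H-colourable : Graph.PackingColourable H k
  H-colourable = paint κ ∘ dec , paint-packing κ κ-hub H dec dec-injective (λ a → a) far
    where
    -- The only repeated label is `inj₁ (suc zero)`, shared by one non-hub of each clique; `join`
    -- sends it to index 1, which is colour 2.
    label : Core → Fin (suc p) ⊎ Fin q
    label (inj₁ i)             = inj₁ i
    label (inj₂ zero)          = inj₂ zero
    label (inj₂ (suc zero))    = inj₁ (suc zero)
    label (inj₂ (suc (suc j))) = inj₂ (suc j)

    κ : Core → Fin k
    κ = join (suc p) q ∘ label

    κ⇒label : ∀ a b → κ a ≡ κ b → label a ≡ label b
    κ⇒label a b eq = trans (sym (splitAt-join (suc p) q (label a)))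
      (trans (cong (splitAt (suc p)) eq) (splitAt-join (suc p) q (label b)))

    κ-hub : ∀ x → κ x ≡ zero → Hub x
    κ-hub (inj₁ zero)          _ = refl
    κ-hub (inj₂ zero)          _ = refl
    κ-hub (inj₂ (suc zero))    ()
    κ-hub (inj₂ (suc (suc _))) ()

    -- A middle vertex in either clique would have to be linked across to a non-hub, and a leaf has
    -- only one neighbour.
    no-link-path : ∀ i j v → Link (inj₁ (suc i) , zero) v → ¬ Link v (inj₂ (suc j) , zero)
    no-link-path i j (inj₁ _ , zero) _        (_ , ())
    no-link-path i j (inj₂ _ , zero) (() , _) _
    no-link-path i j (_ , suc _) (refl , _) (() , _)

    non-hubs-far : ∀ {x y i j} → dec x ≡ (inj₁ (suc i) , zero) → dec y ≡ (inj₂ (suc j) , zero) →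
      x ≢ y → Graph.Distance> H x y 2 × Graph.Distance> H y x 2
    non-hubs-far {x} {y} {i} {j} dx dy x≢y =
      no-common-neighbour⇒Distance>2 x≢y ¬xy path ,
      no-common-neighbour⇒Distance>2 (≢-sym x≢y) (¬xy ∘ Graph.sym H {y} {x})
        λ z yz zx → path z (Graph.sym H {z} {x} zx) (Graph.sym H {y} {z} yz)
      where
      open Packing H

      ¬xy : ¬ Link (dec x) (dec y)
      ¬xy rewrite dx | dy = λ ()

      path : ∀ z → Link (dec x) (dec z) → ¬ Link (dec z) (dec y)
      path z rewrite dx | dy = no-link-path i j (dec z)

    far : ∀ {x y a b} → dec x ≡ (a , zero) → dec y ≡ (b , zero) → x ≢ y → a ≢ b → κ a ≡ κ b →
      Graph.Distance> H x y (suc (toℕ (κ a)))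
    far {x} {y} {a} {b} dx dy x≢y a≢b eq = go a b (κ⇒label a b eq) dx dy a≢b
      where
      go : ∀ a b → label a ≡ label b → dec x ≡ (a , zero) → dec y ≡ (b , zero) → a ≢ b →
        Graph.Distance> H x y (suc (toℕ (κ a)))
      go (inj₁ _) (inj₁ _) refl _ _ a≢b = contradiction refl a≢b
      -- Equality of labels makes the first vertex `inj₁ (suc zero)`, so the distance has to exceed
      -- 2.
      go (inj₁ _) (inj₂ (suc zero)) refl dx dy _ = proj₁ (non-hubs-far dx dy x≢y)
      go (inj₂ (suc zero)) (inj₁ _) refl dx dy _ = proj₂ (non-hubs-far dy dx (≢-sym x≢y))
      go (inj₂ zero) (inj₂ zero) _ _ _ a≢b = contradiction refl a≢b
      go (inj₂ (suc zero)) (inj₂ (suc zero)) _ _ _ a≢b = contradiction refl a≢b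
      go (inj₂ (suc (suc _))) (inj₂ (suc (suc _))) refl _ _ a≢b = contradiction refl a≢b
      go (inj₁ _) (inj₂ zero) ()
      go (inj₁ _) (inj₂ (suc (suc _))) ()
      go (inj₂ zero) (inj₁ _) ()
      go (inj₂ zero) (inj₂ (suc zero)) ()
      go (inj₂ zero) (inj₂ (suc (suc _))) ()
      go (inj₂ (suc zero)) (inj₂ zero) ()
      go (inj₂ (suc zero)) (inj₂ (suc (suc _))) ()
      go (inj₂ (suc (suc _))) (inj₁ _) ()
      go (inj₂ (suc (suc _))) (inj₂ zero) ()
      go (inj₂ (suc (suc _))) (inj₂ (suc zero)) ()

  -- As `k ≤ j` is decidable, its failure may be assumed. That assumption keeps colour 1 off the
  -- non-hubs, from which `k` distinct colours result.
  H-lower-bound : ∀ j → Graph.PackingColourable H j → k ≤ j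
  H-lower-bound j (c , pk) = decidable-stable (k ≤? j) refute
    where
    open Packing H

    non-hub-avoids-1 : ¬ (k ≤ j) → ∀ x → ¬ Hub x → 1 ≤ toℕ (c (core x))
    non-hub-avoids-1 k≰j x ¬hub = n≢0⇒n>0 λ cx≡0 → k≰j (star⇒≤ pk (core x) (λ l → enc (x , suc l))
      (λ l → link⇒adj (x , suc l) (x , zero) (refl , ¬hub))
      (λ eq → suc-injective (cong proj₂ (enc-injective eq))) cx≡0)

    at-most-one : ∀ {P : Fin q → Set} → (∀ i → Dec (P i)) → (∀ {i i′} → P i → P i′ → i ≡ i′) →
      Σ[ i ∈ Fin q ] (∀ i′ → P i′ → i′ ≡ i)
    at-most-one P? unique with any? P?
    ... | yes (i , Pi) = i , λ _ Pi′ → unique Pi′ Pi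
    -- The conclusion is vacuous here, so any index serves as default; `zero` exists because `q` is
    -- a successor.
    ... | no  none     = zero , λ i′ Pi′ → contradiction (i′ , Pi′) none

    -- Omitting the non-hub of the second clique of colour 2, if there is one,
    -- leaves k clique vertices of distinct colours.
    refute : ¬ ¬ (k ≤ j)
    refute k≰j = k≰j (injective⇒≤ {f = c ∘ core ∘ vertex ∘ splitAt (suc p)} λ {s} {t} eq →
      trans (sym (join-splitAt (suc p) q s))
        (trans (cong (join (suc p) q) (distinct _ _ eq)) (join-splitAt (suc p) q t)))
      where
      -- The value 1 of `toℕ` stands for colour 2; two such non-hubs would be adjacent.
      second : Σ[ i ∈ Fin q ] (∀ i′ → toℕ (c (core (inj₂ (suc i′)))) ≡ 1 → i′ ≡ i)
      second = at-most-one (λ _ → _ ℕ.≟ 1) λ {i} {i′} ci ci′ → decidable-stable (i ≟ i′) λ i≢i′ →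
        adjacent⇒≢ pk (core-adj (inj₂ (suc i)) (inj₂ (suc i′)) (i≢i′ ∘ suc-injective))
          (toℕ-injective (trans ci (sym ci′)))

      i₀ : Fin q
      i₀ = proj₁ second

      vertex : Fin (suc p) ⊎ Fin q → Core
      vertex (inj₁ i) = inj₁ i
      -- Skipping `suc i₀` fixes the hub `zero` and sends successors to non-hubs other than
      -- `suc i₀`.
      vertex (inj₂ i) = inj₂ (punchIn (suc i₀) i)

      core≢ : ∀ {i i′} → core (inj₂ i) ≢ core (inj₁ i′)
      core≢ eq with core-injective eq
      ... | ()

      hubs-adj : Graph.Adj H (core (inj₂ zero)) (core (inj₁ zero))
      hubs-adj = core-adj (inj₂ zero) (inj₁ zero) (refl , refl)

      hub-adj₁ : ∀ i → Graph.Adj H (core (inj₁ zero)) (core (inj₁ (suc i)))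
      hub-adj₁ i = core-adj (inj₁ zero) (inj₁ (suc i)) λ ()

      hub-adj₂ : ∀ i → Graph.Adj H (core (inj₂ (suc i))) (core (inj₂ zero))
      hub-adj₂ i = core-adj (inj₂ (suc i)) (inj₂ zero) λ ()

      -- The walks through the hubs have length 1, 2 or 3, so a shared colour must be shown to be at
      -- least that length. Non-hubs avoid colour 1, and omitting `suc i₀` also removes colour 2
      -- from the non-hubs kept in the second clique.
      cross : ∀ i i′ → c (core (inj₂ (punchIn (suc i₀) i))) ≢ c (core (inj₁ i′))
      cross zero    zero     = adjacent⇒≢ pk hubs-adj
      cross zero    (suc i′) eq = close⇒≢ pk core≢ (hubs-adj ◅ hub-adj₁ i′ ◅ ε)
        -- The walk starts at a hub, which might have colour 1; the assumed equality transfers the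
        -- bound from the non-hub at its end.
        (s≤s (subst (1 ≤_) (cong toℕ (sym eq)) (non-hub-avoids-1 k≰j (inj₁ (suc i′)) λ ()))) eq
      cross (suc i) zero     = close⇒≢ pk core≢ (hub-adj₂ _ ◅ hubs-adj ◅ ε)
        (s≤s (non-hub-avoids-1 k≰j (inj₂ (suc _)) λ ()))
      cross (suc i) (suc i′) = close⇒≢ pk core≢ (hub-adj₂ _ ◅ hubs-adj ◅ hub-adj₁ i′ ◅ ε)
        (s≤s (≤∧≢⇒< (non-hub-avoids-1 k≰j (inj₂ (suc _)) λ ())
          λ 1≡c → punchInᵢ≢i i₀ i (proj₂ second _ (sym 1≡c))))

      distinct : ∀ s t → c (core (vertex s)) ≡ c (core (vertex t)) → s ≡ t
      distinct (inj₁ i) (inj₁ i′) eq = cong inj₁ (decidable-stable (i ≟ i′) λ i≢i′ →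
        adjacent⇒≢ pk (core-adj (inj₁ i) (inj₁ i′) i≢i′) eq)
      distinct (inj₁ i) (inj₂ i′) eq = contradiction (sym eq) (cross i′ i)
      distinct (inj₂ i) (inj₁ i′) eq = contradiction eq (cross i i′)
      distinct (inj₂ i) (inj₂ i′) eq = cong inj₂ (decidable-stable (i ≟ i′) λ i≢i′ →
        adjacent⇒≢ pk (core-adj (vertex (inj₂ i)) (vertex (inj₂ i′))
          (i≢i′ ∘ punchIn-injective (suc i₀) i i′)) eq)

-- Choosing the construction according to k - n.

theorem2p2 : ∀ (k n : ℕ) → 3 ≤ k → k + 1 ≤ 2 * n → n ≤ k →
    Σ[ G ∈ Graph ] Σ[ e ∈ Edge G ] (IsPackingChromaticNumber G k × IsPackingChromaticNumber (G -ₑ e) n)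
theorem2p2 k n 3≤k k+1≤2n n≤k =
  subst (λ k → 3 ≤ k → k + 1 ≤ 2 * n → Goal k n) (m+[n∸m]≡n n≤k) (construct n (k ∸ n)) 3≤k k+1≤2n
  where
  Goal : ℕ → ℕ → Set₁
  Goal k n = Σ[ G ∈ Graph ] Σ[ e ∈ Edge G ] (IsPackingChromaticNumber G k × IsPackingChromaticNumber (G -ₑ e) n)

  -- With k = n + q, the lower bound on `n` says exactly that the second clique, on `suc q`
  -- vertices, is no larger than the first, on `n`.
  q<n : ∀ n q → n + q + 1 ≤ 2 * n → suc q ≤ n
  q<n n q n+q+1≤2n = +-cancelˡ-≤ n _ _ (subst₂ _≤_
    (trans (+-assoc n q 1) (cong (n +_) (+-comm q 1))) (cong (n +_) (+-identityʳ n)) n+q+1≤2n)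

  construct : ∀ n q → 3 ≤ n + q → n + q + 1 ≤ 2 * n → Goal (n + q) n
  construct n q 3≤k bound with n | q | q<n n q bound
  ... | suc zero     | zero   | _       = contradiction 3≤k λ { (s≤s ()) }
  ... | suc (suc m)  | zero   | _       = subst (λ k → Goal k (2 + m)) (sym (+-identityʳ (2 + m)))
    (pair+clique (2 + m) , pairEdge (2 + m) , pair+clique-chromatic m)
    where open TwoAndClique
  ... | suc zero     | suc _  | s≤s ()
  ... | suc (suc p′) | suc q′ | s≤s q≤p =
    H , bridge , (H-colourable p′ q′ , H-lower-bound p′ q′) , H⁻-chromatic q≤p
    where open Bridge (suc p′) (suc q′) (2 + p′ + suc q′)
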